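{- Let $\mathbf{B}=\langle B,\oplus,{}',0\rangle$ be a basic algebra. Define, for $x,y\in B$, $x+y=(x'\oplus y)'\oplus y$, $x\cdot y=(x'\oplus y')'$, $\alpha(x)=x'$, and $1=0'$. Then the structure $\mathbf{R}(\mathbf{B})=\langle B,+,\cdot,\alpha,0,1\rangle$ is a Łukasiewicz near semiring.
   Context: A basic algebra is an algebra $\langle A,\oplus,{}',0\rangle$ of type $\langle 2,1,0\rangle$ satisfying, with $1:=0'$: (BA1) $x\oplus 0=x$; (BA2) $x''=x$; (BA3) $(x'\oplus y)'\oplus y=(y'\oplus x)'\oplus x$; (BA4) $(((x\oplus y)'\oplus y)'\oplus z)'\oplus(x\oplus z)=1$. A near semiring is an algebra $\langle R,+,\cdot,0,1\rangle$ such that: (i) $\langle R,+,0\rangle$ is a commutative monoid; (ii) $x\cdot 1=x=1\cdot x$ (multiplication need not be associative or commutative); (iii) $(x+y)\cdot z=(x\cdot z)+(y\cdot z)$; (iv) $x\cdot 0=0\cdot x=0$. It is idempotent if $x+x=x$; then $x\le y$ iff $x+y=y$ defines a partial order, called the induced order. An involutive near semiring is an idempotent near semiring with a map $\alpha:R\to R$ such that $\alpha(\alpha(x))=x$, and $x\le y$ implies $\alpha(y)\le\alpha(x)$. A Łukasiewicz near semiring is an involutive near semiring satisfying the identity $\alpha(x\cdot\alpha(y))\cdot\alpha(y)=\alpha(y\cdot\alpha(x))\cdot\alpha(x)$. -}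

module Defs where

open import Algebra.Core using (Op₁; Op₂)
import Algebra.Definitions
import Algebra.Structures
open import Level using (suc; _⊔_)
open import Relation.Binary.Core using (Rel)
open import Relation.Binary.Structures using (IsEquivalence)

-- Equality is an arbitrary equivalence _≈_ respected by the operations, as in
-- Algebra.Structures; ordinary algebras are the case where _≈_ is _≡_.

module _ {a ℓ} {A : Set a} (_≈_ : Rel A ℓ) where

  open Algebra.Definitions _≈_
  open Algebra.Structures _≈_ using (IsCommutativeMonoid)

  record IsBasicAlgebra (_⊕_ : Op₂ A) (_′ : Op₁ A) (0# : A) : Set (a ⊔ ℓ) where
    field
      isEquivalence : IsEquivalence _≈_
      ⊕-cong        : Congruent₂ _⊕_
      ′-cong        : Congruent₁ _′
      ba₁           : ∀ x → (x ⊕ 0#) ≈ x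
      ba₂           : ∀ x → ((x ′) ′) ≈ x
      ba₃           : ∀ x y → ((((x ′) ⊕ y) ′) ⊕ y) ≈ ((((y ′) ⊕ x) ′) ⊕ x)
      ba₄           : ∀ x y z →
                      (((((((x ⊕ y) ′) ⊕ y) ′) ⊕ z) ′) ⊕ (x ⊕ z)) ≈ (0# ′)

  -- Unlike IsNearSemiring of Algebra.Structures: addition is commutative, there
  -- is a two-sided unit, 0# is a two-sided zero, and multiplication is not
  -- assumed associative.
  record IsNearSemiring (_+_ _·_ : Op₂ A) (0# 1# : A) : Set (a ⊔ ℓ) where
    field
      +-isCommutativeMonoid : IsCommutativeMonoid _+_ 0#
      ·-cong                : Congruent₂ _·_
      ·-identity            : Identity 1# _·_
      distribʳ              : _·_ DistributesOverʳ _+_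
      zero                  : Zero 0# _·_

  record IsIdempotentNearSemiring (_+_ _·_ : Op₂ A) (0# 1# : A) : Set (a ⊔ ℓ) where
    field
      isNearSemiring : IsNearSemiring _+_ _·_ 0# 1#
      +-idem         : Idempotent _+_

  InducedOrder : Op₂ A → Rel A ℓ
  InducedOrder _+_ x y = (x + y) ≈ y

  record IsInvolutiveNearSemiring
         (_+_ _·_ : Op₂ A) (α : Op₁ A) (0# 1# : A) : Set (a ⊔ ℓ) where
    field
      isIdempotentNearSemiring : IsIdempotentNearSemiring _+_ _·_ 0# 1#
      α-cong                   : Congruent₁ α
      α-involutive             : Involutive α
      α-antitone               : ∀ {x y} → InducedOrder _+_ x y →
                                 InducedOrder _+_ (α y) (α x)

  record IsŁukasiewiczNearSemiring
         (_+_ _·_ : Op₂ A) (α : Op₁ A) (0# 1# : A) : Set (a ⊔ ℓ) where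
    field
      isInvolutiveNearSemiring : IsInvolutiveNearSemiring _+_ _·_ α 0# 1#
      łukasiewicz              : ∀ x y →
        (α (x · α y) · α y) ≈ (α (y · α x) · α x)

record BasicAlgebra c ℓ : Set (suc (c ⊔ ℓ)) where
  infix  4 _≈_
  infixl 6 _⊕_
  infixl 8 _′
  field
    Carrier        : Set c
    _≈_            : Rel Carrier ℓ
    _⊕_            : Op₂ Carrier
    _′             : Op₁ Carrier
    0#             : Carrier
    isBasicAlgebra : IsBasicAlgebra _≈_ _⊕_ _′ 0#

  open IsBasicAlgebra isBasicAlgebra public

module R {c ℓ} (B : BasicAlgebra c ℓ) where
  open BasicAlgebra B

  infixl 6 _+_
  infixl 7 _·_

  _+_ : Op₂ Carrier
  x + y = (x ′ ⊕ y) ′ ⊕ y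

  _·_ : Op₂ Carrier
  x · y = (x ′ ⊕ y ′) ′

  α : Op₁ Carrier
  α x = x ′

  1# : Carrier
  1# = 0# ′

{-# OPTIONS --safe #-}

-- The induced order x + y ≈ y coincides with x ′ ⊕ y ≈ 1#, and for it + is the
-- join.  Since ba₄ makes ⊕ monotone in its left argument and x ≤ x + z, the map
-- x ↦ x ′ ⊕ z forms an antitone Galois connection with itself; it therefore turns
-- joins into meets, which is right distributivity of · over +.

module Submission where

open import Defs

open import Algebra.Definitions using (Congruent₂; _DistributesOverʳ_)
open import Data.Product using (_,_)
open import Relation.Binary.Bundles using (Setoid)
open import Relation.Binary.Lattice.Bundles using (JoinSemilattice)
open import Relation.Binary.Structures using (IsEquivalence)
import Relation.Binary.Lattice.Properties.JoinSemilattice as JoinSemilatticeProperties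
import Relation.Binary.Reasoning.Setoid as ≈-Reasoning

module BasicAlgebraProperties {c ℓ} (B : BasicAlgebra c ℓ) where
  open BasicAlgebra B
  open R B
  open IsEquivalence isEquivalence using (refl; sym; trans)

  setoid : Setoid c ℓ
  setoid = record { isEquivalence = isEquivalence }

  open ≈-Reasoning setoid

  infix 4 _≤_
  _≤_ : Carrier → Carrier → Set ℓ
  _≤_ = InducedOrder _≈_ _+_

  ⊕-congˡ : ∀ {x y z} → y ≈ z → x ⊕ y ≈ x ⊕ z
  ⊕-congˡ = ⊕-cong refl

  ⊕-congʳ : ∀ {x y z} → y ≈ z → y ⊕ x ≈ z ⊕ x
  ⊕-congʳ y≈z = ⊕-cong y≈z refl

  +-cong : Congruent₂ _≈_ _+_
  +-cong x≈u y≈v = ⊕-cong (′-cong (⊕-cong (′-cong x≈u) y≈v)) y≈v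

  ·-cong : Congruent₂ _≈_ _·_
  ·-cong x≈u y≈v = ′-cong (⊕-cong (′-cong x≈u) (′-cong y≈v))

  +-comm : ∀ x y → x + y ≈ y + x
  +-comm = ba₃

  +-identityʳ : ∀ x → x + 0# ≈ x
  +-identityʳ x = trans (ba₁ _) (trans (′-cong (ba₁ _)) (ba₂ x))

  +-identityˡ : ∀ x → 0# + x ≈ x
  +-identityˡ x = trans (+-comm 0# x) (+-identityʳ x)

  -- This is `ba₄` at `x ′`, `y`, `0#`. Its instances give the laws for `1#` below, and it also
  -- makes `x + y` an upper bound.
  [x+y]⊕x′≈1 : ∀ x y → (x + y) ⊕ x ′ ≈ 1#
  [x+y]⊕x′≈1 x y = begin
    (x + y) ⊕ x ′                      ≈⟨ ⊕-cong (trans (′-cong (ba₁ _)) (ba₂ _)) (ba₁ _) ⟨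
    ((x + y) ′ ⊕ 0#) ′ ⊕ (x ′ ⊕ 0#)    ≈⟨ ba₄ (x ′) y 0# ⟩
    1#                                 ∎

  x⊕x′≈1 : ∀ x → x ⊕ x ′ ≈ 1#
  x⊕x′≈1 x = trans (⊕-congʳ (sym (+-identityʳ x))) ([x+y]⊕x′≈1 x 0#)

  x′⊕x≈1 : ∀ x → x ′ ⊕ x ≈ 1#
  x′⊕x≈1 x = trans (⊕-congˡ (sym (ba₂ x))) (x⊕x′≈1 (x ′))

  ⊕-zeroʳ : ∀ x → x ⊕ 1# ≈ 1#
  ⊕-zeroʳ x = trans (⊕-congʳ (sym (+-identityˡ x))) ([x+y]⊕x′≈1 0# x)

  ⊕-zeroˡ : ∀ x → 1# ⊕ x ≈ 1#
  ⊕-zeroˡ x = begin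
    -- By definition `x ′ + 1#` ends in `⊕ 1#`, so it collapses by `⊕-zeroʳ`.
    1# ⊕ x                 ≈⟨ ⊕-cong (⊕-zeroʳ _) (ba₂ x) ⟨
    (x ′ + 1#) ⊕ x ′ ′     ≈⟨ [x+y]⊕x′≈1 (x ′) 1# ⟩
    1#                     ∎

  ⊕-identityˡ : ∀ x → 0# ⊕ x ≈ x
  ⊕-identityˡ x = begin
    0# ⊕ x               ≈⟨ ⊕-congʳ (ba₂ 0#) ⟨
    1# ′ ⊕ x             ≈⟨ ⊕-congʳ (′-cong (⊕-zeroˡ x)) ⟨
    (1# ⊕ x) ′ ⊕ x       ≈⟨ +-identityˡ x ⟩
    x                    ∎

  x′⊕y≈1⇒x≤y : ∀ {x y} → x ′ ⊕ y ≈ 1# → x ≤ y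
  x′⊕y≈1⇒x≤y {x} {y} x′⊕y≈1 = begin
    x + y       ≈⟨ ⊕-congʳ (′-cong x′⊕y≈1) ⟩
    1# ′ ⊕ y    ≈⟨ ⊕-congʳ (ba₂ 0#) ⟩
    0# ⊕ y      ≈⟨ ⊕-identityˡ y ⟩
    y           ∎

  -- Since `⊕` need not commute, the swapped order of summands matters: up to `ba₂` it reads
  -- `y ′ ′ ⊕ x ′ ≈ 1#`, the criterion for `y ′ ≤ x ′`.
  x≤y⇒y⊕x′≈1 : ∀ {x y} → x ≤ y → y ⊕ x ′ ≈ 1#
  x≤y⇒y⊕x′≈1 {x} {y} x≤y = trans (⊕-congʳ (sym x≤y)) ([x+y]⊕x′≈1 x y)

  ′-antitone : ∀ {x y} → x ≤ y → y ′ ≤ x ′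
  ′-antitone {x} {y} x≤y = x′⊕y≈1⇒x≤y (trans (⊕-congʳ (ba₂ y)) (x≤y⇒y⊕x′≈1 x≤y))

  ≤-reflexive : ∀ {x y} → x ≈ y → x ≤ y
  ≤-reflexive {x} {y} x≈y =
    x′⊕y≈1⇒x≤y (trans (⊕-congʳ (′-cong x≈y)) (x′⊕x≈1 y))

  ≤-antisym : ∀ {x y} → x ≤ y → y ≤ x → x ≈ y
  ≤-antisym {x} {y} x≤y y≤x = trans (sym y≤x) (trans (+-comm y x) x≤y)

  ≤-resp-≈ : ∀ {x y u v} → x ≈ u → y ≈ v → x ≤ y → u ≤ v
  ≤-resp-≈ x≈u y≈v x≤y = trans (+-cong (sym x≈u) (sym y≈v)) (trans x≤y y≈v)

  ′-swapˡ : ∀ {x y} → x ′ ≤ y → y ′ ≤ x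
  ′-swapˡ {x} x′≤y = ≤-resp-≈ refl (ba₂ x) (′-antitone x′≤y)

  -- Read through the order, `ba₄` says `(x + y) ′ ⊕ z ≤ x ′ ⊕ z`, and `x ≤ y` turns `x + y` into
  -- `y`.
  ⊕-′-antitoneˡ : ∀ {x y} z → x ≤ y → y ′ ⊕ z ≤ x ′ ⊕ z
  ⊕-′-antitoneˡ {x} {y} z x≤y =
    ≤-resp-≈ (⊕-congʳ (′-cong x≤y)) refl (x′⊕y≈1⇒x≤y (ba₄ (x ′) y z))

  -- `x + z` arises from `x` by applying the antitone map `w ↦ w ′ ⊕ z` twice.
  +-monoˡ : ∀ {x y} z → x ≤ y → x + z ≤ y + z
  +-monoˡ z x≤y = ⊕-′-antitoneˡ z (⊕-′-antitoneˡ z x≤y)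

  x≤y+x : ∀ x y → x ≤ y + x
  x≤y+x x y = ≤-resp-≈ (ba₂ x) (+-comm x y)
    (′-swapˡ (x′⊕y≈1⇒x≤y ([x+y]′′⊕x′≈1)))
    where
    [x+y]′′⊕x′≈1 : (x + y) ′ ′ ⊕ x ′ ≈ 1#
    [x+y]′′⊕x′≈1 = trans (⊕-congʳ (ba₂ _)) ([x+y]⊕x′≈1 x y)

  x≤x+y : ∀ x y → x ≤ x + y
  x≤x+y x y = ≤-resp-≈ refl (+-comm y x) (x≤y+x x y)

  +-least : ∀ {x y z} → x ≤ z → y ≤ z → x + y ≤ z
  +-least {x} {y} {z} x≤z y≤z =
    ≤-resp-≈ refl (trans (+-comm z y) y≤z) (+-monoˡ y x≤z)

  ≤-trans : ∀ {x y z} → x ≤ y → y ≤ z → x ≤ z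
  -- The goal unfolds to the equation `x + z ≈ z`, so antisymmetry proves it before associativity is
  -- known: `x + z ≤ y + z ≈ z` and `z ≤ x + z`.
  ≤-trans {x} {y} {z} x≤y y≤z = ≤-antisym
    (≤-resp-≈ refl y≤z (+-monoˡ z x≤y))
    (x≤y+x z x)

  -- Associativity and idempotence of `+` are inherited from its being a join.
  joinSemilattice : JoinSemilattice c ℓ ℓ
  joinSemilattice = record
    { _≈_ = _≈_
    ; _≤_ = _≤_
    ; _∨_ = _+_
    ; isJoinSemilattice = record
      { isPartialOrder = record
        { isPreorder = record
          { isEquivalence = isEquivalence
          ; reflexive     = ≤-reflexive
          ; trans         = ≤-trans
          }
        ; antisym = ≤-antisym
        }
      ; supremum = λ x y → x≤x+y x y , x≤y+x y x , λ z → +-least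
      }
    }

  open JoinSemilatticeProperties joinSemilattice
    using () renaming (∨-assoc to +-assoc; ∨-idempotent to +-idem)

  -- `y ≤ y + z`, and `y + z` is the image of `y ′ ⊕ z` under the antitone map `w ↦ w ′ ⊕ z`.
  ⊕-galois : ∀ {x y z} → x ≤ y ′ ⊕ z → y ≤ x ′ ⊕ z
  ⊕-galois {x} {y} {z} x≤y′⊕z = ≤-trans (x≤x+y y z) (⊕-′-antitoneˡ z x≤y′⊕z)

  ·-monoˡ : ∀ {x y} z → x ≤ y → x · z ≤ y · z
  ·-monoˡ z x≤y = ′-antitone (⊕-′-antitoneˡ (z ′) x≤y)

  -- With its converse below, this makes `_· z` left adjoint to `w ↦ w ′ ′ ⊕ z ′`; the double
  -- complement is the form in which `⊕-galois` delivers it.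
  x·z≤w⇒x≤w′′⊕z′ : ∀ {x z w} → x · z ≤ w → x ≤ w ′ ′ ⊕ z ′
  x·z≤w⇒x≤w′′⊕z′ x·z≤w = ⊕-galois (′-swapˡ x·z≤w)

  x≤w′′⊕z′⇒x·z≤w : ∀ {x z w} → x ≤ w ′ ′ ⊕ z ′ → x · z ≤ w
  x≤w′′⊕z′⇒x·z≤w x≤w′′⊕z′ = ′-swapˡ (⊕-galois x≤w′′⊕z′)

  ·-distribʳ-+ : _DistributesOverʳ_ _≈_ _·_ _+_
  ·-distribʳ-+ z x y = ≤-antisym
    -- A left adjoint preserves joins: with `w = x · z + y · z`, the bound on `x + y` is checked on
    -- each summand across the adjunction.
    (x≤w′′⊕z′⇒x·z≤w (+-least
      (x·z≤w⇒x≤w′′⊕z′ (x≤x+y (x · z) (y · z)))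
      (x·z≤w⇒x≤w′′⊕z′ (x≤y+x (y · z) (x · z)))))
    (+-least (·-monoˡ z (x≤x+y x y)) (·-monoˡ z (x≤y+x y x)))

  ·-identityˡ : ∀ x → 1# · x ≈ x
  ·-identityˡ x = begin
    (1# ′ ⊕ x ′) ′    ≈⟨ ′-cong (⊕-congʳ (ba₂ 0#)) ⟩
    (0# ⊕ x ′) ′      ≈⟨ ′-cong (⊕-identityˡ (x ′)) ⟩
    x ′ ′             ≈⟨ ba₂ x ⟩
    x                 ∎

  ·-identityʳ : ∀ x → x · 1# ≈ x
  ·-identityʳ x = begin
    (x ′ ⊕ 1# ′) ′    ≈⟨ ′-cong (⊕-congˡ (ba₂ 0#)) ⟩
    (x ′ ⊕ 0#) ′      ≈⟨ ′-cong (ba₁ (x ′)) ⟩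
    x ′ ′             ≈⟨ ba₂ x ⟩
    x                 ∎

  ·-zeroˡ : ∀ x → 0# · x ≈ 0#
  ·-zeroˡ x = trans (′-cong (⊕-zeroˡ (x ′))) (ba₂ 0#)

  ·-zeroʳ : ∀ x → x · 0# ≈ 0#
  ·-zeroʳ x = trans (′-cong (⊕-zeroʳ (x ′))) (ba₂ 0#)

  -- This reduces the Łukasiewicz identity to commutativity of `+`.
  α[x·αy]·αy≈α[x+y] : ∀ x y → α (x · α y) · α y ≈ α (x + y)
  α[x·αy]·αy≈α[x+y] x y =
    ′-cong (⊕-cong (′-cong (trans (ba₂ _) (⊕-congˡ (ba₂ y)))) (ba₂ y))

  isŁukasiewiczNearSemiring : IsŁukasiewiczNearSemiring _≈_ _+_ _·_ α 0# 1#
  isŁukasiewiczNearSemiring = record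
    { isInvolutiveNearSemiring = record
      { isIdempotentNearSemiring = record
        { isNearSemiring = record
          { +-isCommutativeMonoid = record
            { isMonoid = record
              { isSemigroup = record
                { isMagma = record
                  { isEquivalence = isEquivalence
                  ; ∙-cong        = +-cong
                  }
                ; assoc = +-assoc
                }
              ; identity = +-identityˡ , +-identityʳ
              }
            ; comm = +-comm
            }
          ; ·-cong     = ·-cong
          ; ·-identity = ·-identityˡ , ·-identityʳ
          ; distribʳ   = ·-distribʳ-+
          ; zero       = ·-zeroˡ , ·-zeroʳ
          }
        ; +-idem = +-idem
        }
      ; α-cong       = ′-cong
      ; α-involutive = ba₂
      ; α-antitone   = ′-antitone
      }
    ; łukasiewicz = λ x y → begin
        α (x · α y) · α y    ≈⟨ α[x·αy]·αy≈α[x+y] x y ⟩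
        α (x + y)            ≈⟨ ′-cong (+-comm x y) ⟩
        α (y + x)            ≈⟨ α[x·αy]·αy≈α[x+y] y x ⟨
        α (y · α x) · α x    ∎
    }

theorem5 : ∀ {c ℓ} (B : BasicAlgebra c ℓ) →
    IsŁukasiewiczNearSemiring (BasicAlgebra._≈_ B)
    (R._+_ B) (R._·_ B) (R.α B) (BasicAlgebra.0# B) (R.1# B)
theorem5 B = BasicAlgebraProperties.isŁukasiewiczNearSemiring B
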